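{- Let $\mathbf P$ be a cyclic CFSM protocol with communication graph $(N,E)$ and let $\beta\in E$. For each $j\in N$ let $V_j\subseteq K_j$ be a set of states such that $h_j\in V_j$ and such that whenever $p_j\xrightarrow{ -b}q_j$ in $F_j$ (for some $b$), $q_j\in V_j$. Then there is an algorithm to decide whether any given family of regular sets $Q(S)\subseteq M_\beta^*$ indexed by $S\in\prod_{j\in N}V_j$ can be extended to a family of sets $Q(S)$ indexed by $S\in\prod_{j\in N}K_j$ that is consistent with respect to $\mathbf P$ and $\beta$. Moreover, if the family can be extended, then the smallest such sets $Q(S)$ are regular and can be automatically constructed.
   Context: A CFSM protocol $\mathbf P$ has a finite directed communication graph $G=(N,E)$ (edge $\xi$ has tail $-\xi$, head $+\xi$), pairwise disjoint finite message sets $M_\xi$, and for each $j\in N$ a finite state machine $F_j=(K_j,\Sigma_j,T_j,h_j)$: finite state set $K_j$, initial state $h_j$, alphabet $\Sigma_j=\{+b: b\in M_\xi,\ j=+\xi\}\cup\{ -b: b\in M_\xi,\ j=-\xi\}$, transitions $T_j\subseteq K_j\times\Sigma_j\times K_j$ written $p\xrightarrow{e}q$ ($+b$ = receive, $-b$ = send). A composite state is $S=(p_j:j\in N)$; a channel content is $C=(x_\xi:\xi\in E)$, $x_\xi\in M_\xi^*$; global states are pairs $(S,C)$. A step: some machine $F_i$ takes $p_i\xrightarrow{ -b}q_i$ with $b\in M_\beta$, $i=-\beta$, appending $b$ to the end of $x_\beta$; or takes $p_i\xrightarrow{+b}q_i$ with $b\in M_\beta$, $i=+\beta$, provided $x_\beta$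 begins with $b$, removing it; all else unchanged. $\vdash^*$ means reachability by finitely many steps. $\mathbf P$ is cyclic if $G$ is a directed cycle. A family $Q(S)\subseteq M_\beta^*$ indexed by all composite states is consistent with respect to $\mathbf P$ and $\beta$ if whenever $(S,(x_\xi))\vdash^*(S',(x'_\xi))$ with $x_\xi=x'_\xi=\lambda$ for all $\xi\neq\beta$ and $x_\beta\in Q(S)$, then $x'_\beta\in Q(S')$. An extension agrees with the given sets on $\prod_j V_j$; "smallest" is with respect to componentwise inclusion. -}

module Defs where

open import Data.Bool using (Bool; T)
open import Data.Fin using (Fin; toℕ)
open import Data.Fin.Subset as Subset using (Subset)
open import Data.List using (List; []; _∷_; _∷ʳ_; foldl)
open import Data.Nat using (ℕ; suc)
open import Data.Nat.DivMod using (_mod_)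
open import Data.Product using (∃; _×_; _,_)
open import Data.Refinement using (Refinement; value)
open import Data.Vec as Vec using (Vec)
open import Data.Vec.Relation.Unary.All using (All)
open import Data.Vec.Relation.Unary.All.Properties using (lookup⁺)
open import Function.Bundles using (_↔_; Inverse)
open import Level using (0ℓ)
open import Relation.Binary.Construct.Closure.ReflexiveTransitive using (Star)
open import Relation.Binary.PropositionalEquality using (_≡_; _≢_)
open import Relation.Unary using (Pred; _∈_; _⊆_; _≐_)

Language : ℕ → Set₁
Language a = Pred (List (Fin a)) 0ℓ

record DFA (a : ℕ) : Set where
  field
    size   : ℕ
    start  : Fin size
    next   : Fin size → Fin a → Fin size
    accept : Subset size

  Accepts : Language a
  Accepts w = foldl next start w Subset.∈ accept

-- A proof of regularity carries an automaton, so regular sets are given,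
-- and constructed, as finite data.
Regular : ∀ {a} → Language a → Set
Regular {a} L = ∃ λ (D : DFA a) → L ≐ DFA.Accepts D

-- Loops and parallel edges are allowed.
record Graph : Set where
  field
    #nodes : ℕ
    #edges : ℕ

  Node = Fin #nodes
  Edge = Fin #edges

  field
    tail : Edge → Node
    head : Edge → Node

-- An isomorphism with the cycle 0 → 1 → ⋯ → m → 0 of length suc m ≥ 1.
record IsDirectedCycle (G : Graph) : Set where
  open Graph G
  field
    m    : ℕ
    node : Fin (suc m) ↔ Node
    edge : Fin (suc m) ↔ Edge

  nodeAt : Fin (suc m) → Node
  nodeAt = Inverse.to node

  edgeAt : Fin (suc m) → Edge
  edgeAt = Inverse.to edge

  field
    tail-edge : ∀ i → tail (edgeAt i) ≡ nodeAt i
    head-edge : ∀ i → head (edgeAt i) ≡ nodeAt (suc (toℕ i) mod suc m)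

-- The sets M ξ are disjoint because a message is always tagged by its edge.
data Action (G : Graph) (M : Graph.Edge G → Set) : Graph.Node G → Set where
  send : ∀ ξ → M ξ → Action G M (Graph.tail G ξ)
  recv : ∀ ξ → M ξ → Action G M (Graph.head G ξ)

record Protocol : Set where
  field
    graph : Graph

  open Graph graph public

  field
    #messages : Vec ℕ #edges
    #states   : Vec ℕ #nodes

  M : Edge → Set
  M ξ = Fin (Vec.lookup #messages ξ)

  K : Node → Set
  K j = Fin (Vec.lookup #states j)

  field
    transition : ∀ j → K j → Action graph M j → K j → Bool
    h          : ∀ j → K j

  infix 4 _─[_]→_
  _─[_]→_ : ∀ {j} → K j → Action graph M j → K j → Set
  p ─[ e ]→ q = T (transition _ p e q)

  -- Elements of ∏ⱼ K j and ∏ξ (M ξ)* are heterogeneous vectors rather than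
  -- dependent functions, so that pointwise equal ones are equal.
  CompositeState : Set
  CompositeState = All Fin #states

  ChannelContent : Set
  ChannelContent = All (λ a → List (Fin a)) #messages

  GlobalState : Set
  GlobalState = CompositeState × ChannelContent

  stateOf : CompositeState → ∀ j → K j
  stateOf = lookup⁺

  contentOf : ChannelContent → ∀ ξ → List (M ξ)
  contentOf = lookup⁺

  infix 4 _⊢_ _⊢*_

  data _⊢_ : GlobalState → GlobalState → Set where
    send-step : ∀ {S S′ C C′} ξ (b : M ξ) →
      stateOf S (tail ξ) ─[ send ξ b ]→ stateOf S′ (tail ξ) →
      (∀ j → j ≢ tail ξ → stateOf S′ j ≡ stateOf S j) →
      contentOf C′ ξ ≡ contentOf C ξ ∷ʳ b →
      (∀ η → η ≢ ξ → contentOf C′ η ≡ contentOf C η) →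
      (S , C) ⊢ (S′ , C′)
    recv-step : ∀ {S S′ C C′} ξ (b : M ξ) →
      stateOf S (head ξ) ─[ recv ξ b ]→ stateOf S′ (head ξ) →
      (∀ j → j ≢ head ξ → stateOf S′ j ≡ stateOf S j) →
      contentOf C ξ ≡ b ∷ contentOf C′ ξ →
      (∀ η → η ≢ ξ → contentOf C′ η ≡ contentOf C η) →
      (S , C) ⊢ (S′ , C′)

  _⊢*_ : GlobalState → GlobalState → Set
  _⊢*_ = Star _⊢_

  MessageLanguage : Edge → Set₁
  MessageLanguage β = Language (Vec.lookup #messages β)

  EmptyExcept : Edge → ChannelContent → Set
  EmptyExcept β C = ∀ ξ → ξ ≢ β → contentOf C ξ ≡ []

  Consistent : (β : Edge) → (CompositeState → MessageLanguage β) → Set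
  Consistent β Q = ∀ {S S′ C C′} →
    (S , C) ⊢* (S′ , C′) → EmptyExcept β C → EmptyExcept β C′ →
    contentOf C β ∈ Q S → contentOf C′ β ∈ Q S′

  StateSets : Set
  StateSets = ∀ j → Subset (Vec.lookup #states j)

  -- ∏ⱼ V j as a subset of ∏ⱼ K j: the membership proof is irrelevant, so a
  -- family indexed by it depends on the composite state only.
  Restricted : StateSets → Set
  Restricted V = Refinement CompositeState (λ S → ∀ j → stateOf S j Subset.∈ V j)

  module _ (β : Edge) (V : StateSets) (Q : Restricted V → MessageLanguage β) where

    IsConsistentExtension : (CompositeState → MessageLanguage β) → Set
    IsConsistentExtension Q̂ = (∀ S → Q̂ (value S) ≐ Q S) × Consistent β Q̂

    Extendable : Set₁
    Extendable = ∃ IsConsistentExtension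

    IsSmallestConsistentExtension : (CompositeState → MessageLanguage β) → Set₁
    IsSmallestConsistentExtension Q̂ =
      IsConsistentExtension Q̂ ×
      (∀ Q′ → IsConsistentExtension Q′ → ∀ S → Q̂ S ⊆ Q′ S)

Cyclic : Protocol → Set
Cyclic P = IsDirectedCycle (Protocol.graph P)

{-# OPTIONS --safe #-}
module Submission where

open import Data.Empty using (⊥)
open import Data.Fin using (Fin; zero; suc; toℕ; fromℕ; inject₁; combine; remQuot)
open import Data.Fin.Properties as Fin using (remQuot-combine; toℕ-fromℕ; toℕ-fromℕ<; toℕ-injective; toℕ-inject₁; toℕ<n)
open import Data.Fin.Subset using (Subset; _∈_)
open import Data.Fin.Subset.Properties using (_∈?_)
open import Data.Irrelevant using ([_])
open import Data.List using (List; []; _∷_; _++_; _∷ʳ_; foldl; map; concatMap; allFin; cartesianProduct; cartesianProductWith)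
open import Data.List.Membership.Propositional as List using (lose)
open import Data.List.Membership.Propositional.Properties using (∈-allFin; ∈-concatMap⁺; ∈-cartesianProduct⁺; ∈-cartesianProductWith⁺)
open import Data.List.Properties using (foldl-∷ʳ; concatMap-++; ++-identityʳ; ++-assoc; ∷-injectiveʳ)
open import Data.List.Relation.Unary.All as ListAll using ()
open import Data.List.Relation.Unary.Any as Any using (Any; here; there; satisfied)
open import Data.Nat as ℕ using (ℕ; zero; suc; _+_; _*_; _∸_; _≤_; _<_; z≤n; s≤s; s≤s⁻¹; _<?_)
open import Data.Nat.DivMod using (_mod_; m<n⇒m%n≡m; n%n≡0; m%n<n)
open import Data.Nat.Properties hiding (_≟_)
open import Data.Product using (∃; ∃₂; _×_; _,_; proj₁; proj₂)
open import Data.Product.Properties using (≡-dec)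
open import Data.Refinement using (Refinement; value; _,_)
open import Data.Sum using (_⊎_; inj₁; inj₂; [_,_]′)
open import Data.Vec as Vec using (Vec; []; _∷_)
open import Data.Vec.Properties using (lookup∘tabulate; lookup⇒[]=; []=⇒lookup)
open import Data.Vec.Relation.Unary.All using (All; []; _∷_)
open import Data.Vec.Relation.Unary.All.Properties using (lookup⁺; lookup⁻)
open import Function using (_∘_; id)
open import Function.Bundles using (Inverse)
open import Level using (0ℓ)
open import Relation.Binary using (Rel; Decidable; DecidableEquality)
open import Relation.Binary.Construct.Closure.ReflexiveTransitive using (Star; ε; _◅_; _◅◅_; kleisliStar)
open import Relation.Binary.PropositionalEquality using (_≡_; _≢_; refl; sym; trans; cong; cong₂; subst; subst₂; module ≡-Reasoning)
open import Relation.Nullary using (Dec; yes; no; ¬_; ¬?; contradiction)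
open import Relation.Nullary.Decidable using (map′; _×-dec_; _⊎-dec_; _→-dec_; T?; does; dec-true; decidable-stable; recompute)
open import Relation.Nullary.Negation using (contradiction-irr)
open import Relation.Unary as Unary using (Pred; _⊆_; _≐_; ∅; _∪_)
open import Defs

-- An execution that starts and ends with all channels but β empty can be
-- rescheduled so that every message on another channel is received as soon as
-- it is sent.  A machine then runs only when its successor on the way from
-- head β to tail β demands a message, and it stops right after a send, that is,
-- in a state of V.  Hence whenever tail β has just sent on β, the composite
-- state lies in ∏ V, where the family Q is given.  The smallest extension
-- therefore consists of what is reachable from Q without sending on β.  Such
-- moves only remove letters from the front of the word on β, under a finite
-- control, so they lead from regular sets to regular sets; and Q is extendable
-- iff the sets obtained in this way stay within Q on ∏ V, also after one
-- further send on β, which is a question of inclusion of regular sets.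

-- Finite types and exhaustive search.

record Finite (A : Set) : Set where
  field
    elements : List A
    complete : ∀ x → x List.∈ elements

open Finite

∀? : ∀ {A : Set} {P : Pred A 0ℓ} → Finite A → Unary.Decidable P → Dec (∀ x → P x)
∀? finite P? = map′ (λ ps x → ListAll.lookup ps (complete finite x)) (λ f → ListAll.tabulate λ {x} _ → f x)
  (ListAll.all? P? (elements finite))

finite-Fin : ∀ n → Finite (Fin n)
finite-Fin n .elements = allFin n
finite-Fin n .complete = ∈-allFin

finite-× : ∀ {A B} → Finite A → Finite B → Finite (A × B)
finite-× FA FB .elements = cartesianProduct (elements FA) (elements FB)
finite-× FA FB .complete (x , y) = ∈-cartesianProduct⁺ (complete FA x) (complete FB y)

finite-Refinement : ∀ {A : Set} {P : Pred A 0ℓ} → Finite A → Unary.Decidable P → Finite (Refinement A P)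
finite-Refinement {A} {P} finite P? = record
  { elements = concatMap refine (elements finite)
  ; complete = λ { (x , [ px ]) → ∈-concatMap⁺ refine (lose (complete finite x) (∈-refine px)) }
  }
  where
  refine : A → List (Refinement A P)
  refine x with P? x
  ... | yes px = (x , [ px ]) ∷ []
  ... | no  _  = []

  ∈-refine : ∀ {x} → .(px : P x) → (x , [ px ]) List.∈ refine x
  ∈-refine {x} px with P? x
  -- The list carries the proof found by `P?`; `refl` suffices because proofs in a refinement are
  -- irrelevant.
  ... | yes _  = here refl
  ... | no ¬px = contradiction-irr px ¬px

finite-All-Fin : ∀ {n} (ns : Vec ℕ n) → Finite (All Fin ns)
finite-All-Fin [] .elements = [] ∷ []
finite-All-Fin [] .complete [] = here refl
finite-All-Fin (n ∷ ns) .elements = cartesianProductWith _∷_ (allFin n) (elements (finite-All-Fin ns))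
finite-All-Fin (n ∷ ns) .complete (i ∷ is) =
  ∈-cartesianProductWith⁺ _∷_ (∈-allFin i) (complete (finite-All-Fin ns) is)

-- Decidable reachability in finite graphs.

module Reachability {A : Set} (_≟_ : DecidableEquality A) {E : Rel A 0ℓ} (E? : Decidable E) where

  -- Paths all of whose intermediate vertices belong to the list, as in the
  -- Floyd–Warshall algorithm.
  Via : List A → Rel A 0ℓ
  Via []       x y = x ≡ y ⊎ E x y
  Via (v ∷ vs) x y = Via vs x y ⊎ Via vs x v × Via vs v y

  Via? : ∀ vs → Decidable (Via vs)
  Via? []       x y = (x ≟ y) ⊎-dec E? x y
  Via? (v ∷ vs) x y = Via? vs x y ⊎-dec (Via? vs x v ×-dec Via? vs v y)

  via-edge : ∀ vs {x y} → x ≡ y ⊎ E x y → Via vs x y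
  via-edge []       = id
  via-edge (v ∷ vs) = inj₁ ∘ via-edge vs

  via-to-head : ∀ {v vs x} → Via (v ∷ vs) x v → Via vs x v
  via-to-head = [ id , proj₁ ]′

  via-from-head : ∀ {v vs y} → Via (v ∷ vs) v y → Via vs v y
  via-from-head = [ id , proj₂ ]′

  via-trans : ∀ {v vs x y} → v List.∈ vs → Via vs x v → Via vs v y → Via vs x y
  via-trans (here refl) p q = inj₂ (via-to-head p , via-from-head q)
  via-trans (there v∈vs) (inj₁ p)       (inj₁ q)        = inj₁ (via-trans v∈vs p q)
  via-trans (there v∈vs) (inj₁ p)       (inj₂ (q , q′)) = inj₂ (via-trans v∈vs p q , q′)
  via-trans (there v∈vs) (inj₂ (p , p′)) (inj₁ q)       = inj₂ (p , via-trans v∈vs p′ q)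
  -- Both halves visit the head of the list; the loop between the two visits is dropped.
  via-trans (there v∈vs) (inj₂ (p , p′)) (inj₂ (q , q′)) = inj₂ (p , q′)

  via⇒star : ∀ vs {x y} → Via vs x y → Star E x y
  via⇒star []       (inj₁ refl) = ε
  via⇒star []       (inj₂ e)    = e ◅ ε
  via⇒star (v ∷ vs) (inj₁ p)    = via⇒star vs p
  via⇒star (v ∷ vs) (inj₂ (p , q)) = via⇒star vs p ◅◅ via⇒star vs q

  star⇒via : (finite : Finite A) → ∀ {x y} → Star E x y → Via (elements finite) x y
  star⇒via finite ε = via-edge (elements finite) (inj₁ refl)
  star⇒via finite (e ◅ p) =
    via-trans (complete finite _) (via-edge (elements finite) (inj₂ e)) (star⇒via finite p)

  star? : Finite A → Decidable (Star E)
  star? finite x y = map′ (via⇒star _) (star⇒via finite) (Via? (elements finite) x y)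

-- Closure properties and decision procedures for regular languages.

subsetOf : ∀ {n} {P : Pred (Fin n) 0ℓ} → Unary.Decidable P → Subset n
subsetOf P? = Vec.tabulate (does ∘ P?)

∈-subsetOf : ∀ {n} {P : Pred (Fin n) 0ℓ} (P? : Unary.Decidable P) → P ≐ (_∈ subsetOf P?)
∈-subsetOf P? .proj₁ {x} px =
  lookup⇒[]= x _ (trans (lookup∘tabulate (does ∘ P?) x) (dec-true (P? x) px))
∈-subsetOf P? .proj₂ {x} x∈ with P? x | trans (sym (lookup∘tabulate (does ∘ P?) x)) ([]=⇒lookup x∈)
... | yes px | _ = px
... | no _   | ()

module _ {a : ℕ} where

  private variable
    L L₁ L₂ : Language a

  regular-resp-≐ : L₁ ≐ L₂ → Regular L₁ → Regular L₂
  regular-resp-≐ (f , g) (D , to , from) = D , to ∘ g , f ∘ from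

  regular-fromDec : ∀ {n} (start : Fin n) (next : Fin n → Fin a → Fin n) {P : Pred (Fin n) 0ℓ} →
    Unary.Decidable P → Regular (P ∘ foldl next start)
  regular-fromDec start next P? =
    record { start = start ; next = next ; accept = subsetOf P? } ,
    ∈-subsetOf P? .proj₁ , ∈-subsetOf P? .proj₂

  regular-∈? : Regular L → Unary.Decidable L
  regular-∈? (D , to , from) w = map′ from to (_ ∈? DFA.accept D)

  regular-∅ : Regular (∅ {A = List (Fin a)})
  regular-∅ = regular-fromDec {n = 1} zero (λ _ _ → zero) {P = λ _ → ⊥} (λ _ → no λ ())

  module _ (D₁ D₂ : DFA a) where
    private
      module D₁ = DFA D₁
      module D₂ = DFA D₂

    productNext : Fin (D₁.size * D₂.size) → Fin a → Fin (D₁.size * D₂.size)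
    productNext s b = let p , q = remQuot D₂.size s in combine (D₁.next p b) (D₂.next q b)

    productNext-combine : ∀ p q b → productNext (combine p q) b ≡ combine (D₁.next p b) (D₂.next q b)
    productNext-combine p q b =
      cong (λ (p , q) → combine (D₁.next p b) (D₂.next q b)) (remQuot-combine p q)

    foldl-productNext : ∀ w p q →
      remQuot D₂.size (foldl productNext (combine p q) w) ≡ (foldl D₁.next p w , foldl D₂.next q w)
    foldl-productNext []      p q = remQuot-combine p q
    foldl-productNext (b ∷ w) p q rewrite productNext-combine p q b = foldl-productNext w _ _

    -- One product automaton serves for union and difference; only the condition on the pair of
    -- final states varies.
    regular-product : {P : Pred (Fin D₁.size × Fin D₂.size) 0ℓ} → Unary.Decidable P →
      Regular (λ w → P (foldl D₁.next D₁.start w , foldl D₂.next D₂.start w))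
    regular-product {P} P? = regular-resp-≐
      ((λ {w} → subst P (foldl-productNext w _ _)) , (λ {w} → subst P (sym (foldl-productNext w _ _))))
      (regular-fromDec (combine D₁.start D₂.start) productNext (P? ∘ remQuot D₂.size))

  regular-∪ : Regular L₁ → Regular L₂ → Regular (L₁ ∪ L₂)
  regular-∪ (D₁ , to₁ , from₁) (D₂ , to₂ , from₂) = regular-resp-≐
    ([ inj₁ ∘ from₁ , inj₂ ∘ from₂ ]′ , [ inj₁ ∘ to₁ , inj₂ ∘ to₂ ]′)
    (regular-product D₁ D₂ λ (p , q) → (p ∈? DFA.accept D₁) ⊎-dec (q ∈? DFA.accept D₂))

  regular-∖ : Regular L₁ → Regular L₂ → Regular (λ w → L₁ w × ¬ L₂ w)
  regular-∖ (D₁ , to₁ , from₁) (D₂ , to₂ , from₂) = regular-resp-≐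
    ((λ (p , ¬q) → from₁ p , ¬q ∘ to₂) , (λ (p , ¬q) → to₁ p , ¬q ∘ from₂))
    (regular-product D₁ D₂ λ (p , q) → (p ∈? DFA.accept D₁) ×-dec ¬? (q ∈? DFA.accept D₂))

  -- The accepting states become those from which `b` leads to acceptance. This right quotient
  -- expresses that appending `b` to a word leads into a given set.
  regular-∷ʳ : ∀ b → Regular L → Regular (λ w → L (w ∷ʳ b))
  regular-∷ʳ b (D , to , from) = regular-resp-≐
    ((λ {w} → from ∘ subst (_∈ accept) (sym (foldl-∷ʳ next start b w))) ,
     (λ {w} → subst (_∈ accept) (foldl-∷ʳ next start b w) ∘ to))
    (regular-fromDec start next (λ q → next q b ∈? accept))
    where open DFA D

  regular-× : ∀ {P : Set} → Dec P → Regular L → Regular (λ w → P × L w)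
  regular-× (yes p) R = regular-resp-≐ ((p ,_) , proj₂) R
  regular-× (no ¬p) R = regular-resp-≐ ((λ ()) , (λ (p , _) → contradiction p ¬p)) regular-∅

  regular-Any : ∀ {A : Set} {Ls : A → Language a} → (∀ x → Regular (Ls x)) →
    ∀ xs → Regular (λ w → Any (λ x → Ls x w) xs)
  regular-Any R []       = regular-resp-≐ ((λ ()) , (λ ())) regular-∅
  regular-Any R (x ∷ xs) = regular-resp-≐ (Any.fromSum , Any.toSum) (regular-∪ (R x) (regular-Any R xs))

  regular-∃ : ∀ {A : Set} {Ls : A → Language a} → Finite A → (∀ x → Regular (Ls x)) →
    Regular (λ w → ∃ λ x → Ls x w)
  regular-∃ finite R = regular-resp-≐
    (satisfied , λ (x , p) → lose (complete finite x) p) (regular-Any R (elements finite))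

  module _ (D : DFA a) where
    open DFA D

    Successor : Rel (Fin size) 0ℓ
    Successor p q = ∃ λ b → next p b ≡ q

    path⇒word : ∀ {p q} → Star Successor p q → ∃ λ w → foldl next p w ≡ q
    path⇒word ε = [] , refl
    path⇒word ((b , refl) ◅ r) = let w , eq = path⇒word r in b ∷ w , eq

    word⇒path : ∀ w {p} → Star Successor p (foldl next p w)
    word⇒path []      = ε
    word⇒path (b ∷ w) = (b , refl) ◅ word⇒path w

    -- The letters along a path can be read off, so nonemptiness is reachability of an accepting
    -- state from the start.
    inhabited? : Dec (∃ Accepts)
    inhabited? = map′
      (λ (q , r , q∈) → let w , eq = path⇒word r in w , subst (_∈ accept) (sym eq) q∈)
      (λ (w , w∈) → _ , word⇒path w , w∈)
      (Fin.any? λ q → star? (finite-Fin size) start q ×-dec (q ∈? accept))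
      where open Reachability Fin._≟_ {Successor} (λ p q → Fin.any? λ b → next p b Fin.≟ q)

  regular-inhabited? : Regular L → Dec (∃ L)
  regular-inhabited? (D , to , from) =
    map′ (λ (w , p) → w , from p) (λ (w , p) → w , to p) (inhabited? D)

  regular-⊆? : Regular L₁ → Regular L₂ → Dec (L₁ ⊆ L₂)
  regular-⊆? R₁ R₂ = map′
    -- Emptiness of the difference gives only a double negation, which decidable membership removes.
    (λ ¬∃ {w} p → decidable-stable (regular-∈? R₂ w) λ ¬q → ¬∃ (w , p , ¬q))
    (λ L₁⊆L₂ (w , p , ¬q) → ¬q (L₁⊆L₂ p))
    (¬? (regular-inhabited? (regular-∖ R₁ R₂)))

-- Consuming a word from the front under a finite control.

module Consumption {a : ℕ} {A : Set} (finite : Finite A) (_≟_ : DecidableEquality A)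
  {Silent : Rel A 0ℓ} (Silent? : Decidable Silent)
  {Read : Fin a → Rel A 0ℓ} (Read? : ∀ b → Decidable (Read b)) where

  infix 4 _↝_ _↝*_

  data _↝_ : Rel (A × List (Fin a)) 0ℓ where
    silent : ∀ {s t x} → Silent s t → (s , x) ↝ (t , x)
    read   : ∀ {s t x b} → Read b s t → (s , b ∷ x) ↝ (t , x)

  _↝*_ : Rel (A × List (Fin a)) 0ℓ
  _↝*_ = Star _↝_

  module _ (D : DFA a) where
    open DFA D

    -- The second component is the state of `D` after the letters consumed so far: silent moves
    -- leave it in place, reads advance it.
    ProductEdge : Rel (A × Fin size) 0ℓ
    ProductEdge (s , p) (t , q) = Silent s t × p ≡ q ⊎ ∃ λ b → Read b s t × next p b ≡ q

    ProductEdge? : Decidable ProductEdge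
    ProductEdge? (s , p) (t , q) =
      (Silent? s t ×-dec p Fin.≟ q) ⊎-dec Fin.any? λ b → Read? b s t ×-dec next p b Fin.≟ q

    residual⇒ : ∀ {s t p x y} → (s , x) ↝* (t , y) → foldl next p x ∈ accept →
      ∃ λ q → Star ProductEdge (s , p) (t , q) × foldl next q y ∈ accept
    residual⇒ ε x∈ = _ , ε , x∈
    residual⇒ (silent e ◅ r) x∈ = let q , r′ , y∈ = residual⇒ r x∈ in q , inj₁ (e , refl) ◅ r′ , y∈
    residual⇒ (read e ◅ r) x∈ = let q , r′ , y∈ = residual⇒ r x∈ in q , inj₂ (_ , e , refl) ◅ r′ , y∈

    residual⇐ : ∀ {s t p q y} → Star ProductEdge (s , p) (t , q) → foldl next q y ∈ accept →
      ∃ λ x → (s , x) ↝* (t , y) × foldl next p x ∈ accept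
    residual⇐ ε y∈ = _ , ε , y∈
    residual⇐ (inj₁ (e , refl) ◅ r) y∈ = let x , r′ , x∈ = residual⇐ r y∈ in x , silent e ◅ r′ , x∈
    residual⇐ (inj₂ (b , e , refl) ◅ r) y∈ = let x , r′ , x∈ = residual⇐ r y∈ in b ∷ x , read e ◅ r′ , x∈

  -- Whether `(t , q)` is reachable from `(s , start)` does not depend on the word. The residual is
  -- therefore a finite union, over the reachable `q`, of the words that `D` accepts from `q`.
  regular-residual : ∀ {L : Language a} → Regular L → ∀ s t →
    Regular (λ y → ∃ λ x → x Unary.∈ L × (s , x) ↝* (t , y))
  regular-residual (D , to , from) s t = regular-resp-≐
    ((λ (q , r , y∈) → let x , r′ , x∈ = residual⇐ D r y∈ in x , from x∈ , r′) ,
     (λ (x , x∈ , r) → residual⇒ D r (to x∈)))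
    (regular-∃ (finite-Fin size) λ q → regular-×
      (star? (finite-× finite (finite-Fin size)) (s , start) (t , q))
      (record D { start = q } , id , id))
    where
      open DFA D
      open Reachability (≡-dec _≟_ Fin._≟_) (ProductEdge? D)

-- Opening a directed cycle at an edge.

-- A directed cycle opened at the edge β becomes a line from head β to tail β.
record Line (G : Graph) (β : Graph.Edge G) : Set where
  open Graph G
  field
    incoming       : ∀ j → ∃ λ ξ → head ξ ≡ j
    outgoing       : ∀ j → ∃ λ ξ → tail ξ ≡ j
    head-injective : ∀ {ξ η} → head ξ ≡ head η → ξ ≡ η
    tail-injective : ∀ {ξ η} → tail ξ ≡ tail η → ξ ≡ η
    rank           : Node → ℕ
    rank-injective : ∀ {i j} → rank i ≡ rank j → i ≡ j
    rank-head-β    : rank (head β) ≡ 0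
    rank-head      : ∀ {ξ} → ξ ≢ β → rank (head ξ) ≡ suc (rank (tail ξ))
    rank≤tail-β    : ∀ j → rank j ≤ rank (tail β)

  -- Only `β` can be a loop, so a message on any other edge involves two distinct machines.
  head≢tail : ∀ {ξ} → ξ ≢ β → head ξ ≢ tail ξ
  head≢tail ξ≢β eq = 1+n≢n (trans (sym (rank-head ξ≢β)) (cong rank eq))

module _ {m k : ℕ} (k≤m : k ≤ m) where

  -- The distance from the successor of k to i along the cycle 0 → 1 → ⋯ → m → 0.
  offset : ℕ → ℕ
  offset i with k <? i
  ... | yes _ = i ∸ suc k
  ... | no  _ = i + (m ∸ k)

  offset-> : ∀ {i} → k < i → offset i ≡ i ∸ suc k
  offset-> {i} k<i with k <? i
  ... | yes _ = refl
  ... | no k≮i = contradiction k<i k≮i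

  offset-≤ : ∀ {i} → i ≤ k → offset i ≡ i + (m ∸ k)
  offset-≤ {i} i≤k with k <? i
  ... | yes k<i = contradiction i≤k (<⇒≱ k<i)
  ... | no _ = refl

  offset-k : offset k ≡ m
  offset-k = trans (offset-≤ ≤-refl) (m+[n∸m]≡n k≤m)

  -- Positions after `k` come first on the opened cycle, which rules out collisions between the two
  -- branches of `offset`.
  offset-<-≤ : ∀ {i j} → i ≤ m → k < i → j ≤ k → offset i < offset j
  offset-<-≤ {i} {j} i≤m k<i j≤k rewrite offset-> k<i | offset-≤ j≤k = begin
    suc (i ∸ suc k)  ≡⟨ sym (+-∸-assoc 1 k<i) ⟩
    i ∸ k            ≤⟨ ∸-monoˡ-≤ k i≤m ⟩
    m ∸ k            ≤⟨ m≤n+m (m ∸ k) j ⟩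
    j + (m ∸ k)      ∎
    where open ≤-Reasoning

  offset≤m : ∀ {i} → i ≤ m → offset i ≤ m
  offset≤m {i} i≤m with k <? i
  ... | yes _ = ≤-trans (m∸n≤m i (suc k)) i≤m
  ... | no k≮i = ≤-trans (+-monoˡ-≤ (m ∸ k) (≮⇒≥ k≮i)) (≤-reflexive (m+[n∸m]≡n k≤m))

  offset-injective : ∀ {i j} → i ≤ m → j ≤ m → offset i ≡ offset j → i ≡ j
  offset-injective {i} {j} i≤m j≤m eq with <-≤-connex k i | <-≤-connex k j
  ... | inj₁ k<i | inj₁ k<j =
    ∸-cancelʳ-≡ k<i k<j (trans (sym (offset-> k<i)) (trans eq (offset-> k<j)))
  ... | inj₁ k<i | inj₂ j≤k = contradiction eq (<⇒≢ (offset-<-≤ i≤m k<i j≤k))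
  ... | inj₂ i≤k | inj₁ k<j = contradiction (sym eq) (<⇒≢ (offset-<-≤ j≤m k<j i≤k))
  ... | inj₂ i≤k | inj₂ j≤k =
    +-cancelʳ-≡ (m ∸ k) i j (trans (sym (offset-≤ i≤k)) (trans eq (offset-≤ j≤k)))

  -- The step out of `k` is the cut, where the offset falls from `m` to 0; it has to be excluded.
  offset-suc : ∀ {i} → i < m → i ≢ k → offset (suc i) ≡ suc (offset i)
  offset-suc {i} i<m i≢k with <-≤-connex k i
  ... | inj₁ k<i rewrite offset-> k<i | offset-> (m<n⇒m<1+n k<i) = +-∸-assoc 1 k<i
  ... | inj₂ i≤k rewrite offset-≤ i≤k | offset-≤ (≤∧≢⇒< i≤k i≢k) = refl

  -- The wrap-around from `m` to 0 is an ordinary step unless it is the cut itself.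
  offset-zero : m ≢ k → offset 0 ≡ suc (offset m)
  offset-zero m≢k = trans (offset-≤ z≤n) (trans (+-∸-assoc 1 k<m) (cong suc (sym (offset-> k<m))))
    where
    k<m : k < m
    k<m = ≤∧≢⇒< k≤m (m≢k ∘ sym)

module _ {m : ℕ} where

  cyclicSuc : Fin (suc m) → Fin (suc m)
  cyclicSuc i = suc (toℕ i) mod suc m

  toℕ-cyclicSuc : ∀ i → toℕ (cyclicSuc i) ≡ suc (toℕ i) ℕ.% suc m
  toℕ-cyclicSuc i = toℕ-fromℕ< (m%n<n (suc (toℕ i)) (suc m))

  toℕ-cyclicSuc-< : ∀ {i} → toℕ i < m → toℕ (cyclicSuc i) ≡ suc (toℕ i)
  toℕ-cyclicSuc-< {i} i<m = trans (toℕ-cyclicSuc i) (m<n⇒m%n≡m (s≤s i<m))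

  toℕ-cyclicSuc-≡ : ∀ {i} → toℕ i ≡ m → toℕ (cyclicSuc i) ≡ 0
  toℕ-cyclicSuc-≡ {i} eq = trans (toℕ-cyclicSuc i) (trans (cong (λ n → suc n ℕ.% suc m) eq) (n%n≡0 (suc m)))

  cyclicPred : Fin (suc m) → Fin (suc m)
  cyclicPred zero    = fromℕ m
  cyclicPred (suc i) = inject₁ i

  cyclicSuc-cyclicPred : ∀ i → cyclicSuc (cyclicPred i) ≡ i
  cyclicSuc-cyclicPred zero    = toℕ-injective (toℕ-cyclicSuc-≡ (toℕ-fromℕ m))
  cyclicSuc-cyclicPred (suc i) = toℕ-injective (trans
    (toℕ-cyclicSuc-< (subst (_< m) (sym (toℕ-inject₁ i)) (toℕ<n i))) (cong suc (toℕ-inject₁ i)))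

cycle⇒line : ∀ {G} → IsDirectedCycle G → ∀ β → Line G β
cycle⇒line {G} cycle β = record
  { incoming       = incoming
  ; outgoing       = λ j → edgeAt (position j) , trans (tail-edge _) (Inverse.strictlyInverseˡ node j)
  ; head-injective = head-injective
  ; tail-injective = tail-injective
  ; rank           = rank
  ; rank-injective = rank-injective
  ; rank-head-β    = rank-head-β
  ; rank-head      = rank-head
  ; rank≤tail-β    = λ j → subst (rank j ≤_) (sym rank-tail-β) (offset≤m k≤m (index≤m (position j)))
  }
  where
  open Graph G
  open IsDirectedCycle cycle

  position : Node → Fin (suc m)
  position = Inverse.from node

  index : Edge → Fin (suc m)
  index = Inverse.from edge

  index≤m : ∀ (i : Fin (suc m)) → toℕ i ≤ m
  index≤m i = s≤s⁻¹ (toℕ<n i)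

  -- The cut is made after the position of `tail β`, so that ranks start from 0 at `head β`.
  k = toℕ (index β)

  k≤m : k ≤ m
  k≤m = index≤m (index β)

  position-tail : ∀ ξ → position (tail ξ) ≡ index ξ
  position-tail ξ = begin
    position (tail ξ)                  ≡⟨ cong (position ∘ tail) (Inverse.strictlyInverseˡ edge ξ) ⟨
    position (tail (edgeAt (index ξ))) ≡⟨ cong position (tail-edge (index ξ)) ⟩
    position (nodeAt (index ξ))        ≡⟨ Inverse.strictlyInverseʳ node (index ξ) ⟩
    index ξ                            ∎
    where open ≡-Reasoning

  position-head : ∀ ξ → position (head ξ) ≡ cyclicSuc (index ξ)
  position-head ξ = begin
    position (head ξ)                  ≡⟨ cong (position ∘ head) (Inverse.strictlyInverseˡ edge ξ) ⟨
    position (head (edgeAt (index ξ))) ≡⟨ cong position (head-edge (index ξ)) ⟩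
    position (nodeAt (cyclicSuc (index ξ))) ≡⟨ Inverse.strictlyInverseʳ node (cyclicSuc (index ξ)) ⟩
    cyclicSuc (index ξ)                     ∎
    where open ≡-Reasoning

  index-injective : ∀ {ξ η} → index ξ ≡ index η → ξ ≡ η
  index-injective eq = trans (sym (Inverse.strictlyInverseˡ edge _))
    (trans (cong edgeAt eq) (Inverse.strictlyInverseˡ edge _))

  position-injective : ∀ {i j} → position i ≡ position j → i ≡ j
  position-injective eq = trans (sym (Inverse.strictlyInverseˡ node _))
    (trans (cong nodeAt eq) (Inverse.strictlyInverseˡ node _))

  rank : Node → ℕ
  rank j = offset k≤m (toℕ (position j))

  rank-injective : ∀ {i j} → rank i ≡ rank j → i ≡ j
  rank-injective = position-injective ∘ toℕ-injective ∘ offset-injective k≤m (index≤m _) (index≤m _)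

  rank-tail : ∀ ξ → rank (tail ξ) ≡ offset k≤m (toℕ (index ξ))
  rank-tail ξ = cong (offset k≤m ∘ toℕ) (position-tail ξ)

  rank-tail-β : rank (tail β) ≡ m
  rank-tail-β = trans (rank-tail β) (offset-k k≤m)

  rank-head-cyclicSuc : ∀ ξ → rank (head ξ) ≡ offset k≤m (toℕ (cyclicSuc (index ξ)))
  rank-head-cyclicSuc ξ = cong (offset k≤m ∘ toℕ) (position-head ξ)

  rank-head-β : rank (head β) ≡ 0
  rank-head-β with m≤n⇒m<n∨m≡n k≤m
  ... | inj₁ k<m = trans (rank-head-cyclicSuc β) (trans (cong (offset k≤m) (toℕ-cyclicSuc-< k<m))
                     (trans (offset-> k≤m ≤-refl) (n∸n≡0 (suc k))))
  ... | inj₂ k≡m = trans (rank-head-cyclicSuc β) (trans (cong (offset k≤m) (toℕ-cyclicSuc-≡ k≡m))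
                     (trans (offset-≤ k≤m z≤n) (m≤n⇒m∸n≡0 (≤-reflexive (sym k≡m)))))

  rank-head : ∀ {ξ} → ξ ≢ β → rank (head ξ) ≡ suc (rank (tail ξ))
  rank-head {ξ} ξ≢β with m≤n⇒m<n∨m≡n (index≤m (index ξ))
  ... | inj₁ i<m = trans (rank-head-cyclicSuc ξ) (trans (cong (offset k≤m) (toℕ-cyclicSuc-< i<m))
                     (trans (offset-suc k≤m i<m (ξ≢β ∘ index-injective ∘ toℕ-injective))
                       (cong suc (sym (rank-tail ξ)))))
  ... | inj₂ i≡m = trans (rank-head-cyclicSuc ξ) (trans (cong (offset k≤m) (toℕ-cyclicSuc-≡ i≡m))
                     (trans (offset-zero k≤m (ξ≢β ∘ index-injective ∘ toℕ-injective ∘ trans i≡m))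
                       (cong suc (trans (cong (offset k≤m) (sym i≡m)) (sym (rank-tail ξ))))))

  incoming : ∀ j → ∃ λ ξ → head ξ ≡ j
  incoming j = edgeAt (cyclicPred (position j)) ,
    trans (head-edge _) (trans (cong nodeAt (cyclicSuc-cyclicPred (position j))) (Inverse.strictlyInverseˡ node j))

  tail-injective : ∀ {ξ η} → tail ξ ≡ tail η → ξ ≡ η
  tail-injective {ξ} {η} eq =
    index-injective (trans (sym (position-tail ξ)) (trans (cong position eq) (position-tail η)))

  -- Rank 0 singles out `head β` among the heads. For two other edges, equal heads force equal ranks
  -- of the tails.
  head-injective : ∀ {ξ η} → head ξ ≡ head η → ξ ≡ η
  head-injective {ξ} {η} eq with ξ Fin.≟ β | η Fin.≟ β
  ... | yes ξ≡β | yes η≡β = trans ξ≡β (sym η≡β)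
  ... | yes refl | no η≢β = contradiction (trans (sym rank-head-β) (trans (cong rank eq) (rank-head η≢β))) 0≢1+n
  ... | no ξ≢β | yes refl = contradiction (trans (sym rank-head-β) (trans (cong rank (sym eq)) (rank-head ξ≢β))) 0≢1+n
  ... | no ξ≢β | no η≢β = tail-injective (rank-injective (suc-injective
    (trans (sym (rank-head ξ≢β)) (trans (cong rank eq) (rank-head η≢β)))))

-- Pointwise updates of heterogeneous vectors and of dependent functions.

module _ {A : Set} {P : A → Set} where

  lookup⁺∘lookup⁻ : ∀ {n} {xs : Vec A n} (f : ∀ i → P (Vec.lookup xs i)) i →
    lookup⁺ (lookup⁻ {P = P} {xs = xs} f) i ≡ f i
  lookup⁺∘lookup⁻ {xs = _ ∷ _} f zero    = refl
  lookup⁺∘lookup⁻ {xs = _ ∷ xs} f (suc i) = lookup⁺∘lookup⁻ {xs = xs} (f ∘ suc) i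

  lookup⁺-ext : ∀ {n} {xs : Vec A n} {ps qs : All P xs} → (∀ i → lookup⁺ ps i ≡ lookup⁺ qs i) → ps ≡ qs
  lookup⁺-ext {ps = []}    {[]}    eq = refl
  lookup⁺-ext {ps = _ ∷ _} {_ ∷ _} eq = cong₂ _∷_ (eq zero) (lookup⁺-ext (eq ∘ suc))

  replace : ∀ {n} {xs : Vec A n} → All P xs → ∀ i → P (Vec.lookup xs i) → All P xs
  replace (_ ∷ ps) zero    q = q ∷ ps
  replace (p ∷ ps) (suc i) q = p ∷ replace ps i q

  lookup⁺-replace : ∀ {n} {xs : Vec A n} (ps : All P xs) i q → lookup⁺ (replace ps i q) i ≡ q
  lookup⁺-replace (_ ∷ ps) zero    q = refl
  lookup⁺-replace (_ ∷ ps) (suc i) q = lookup⁺-replace ps i q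

  lookup⁺-replace-≢ : ∀ {n} {xs : Vec A n} (ps : All P xs) {i q j} → j ≢ i →
    lookup⁺ (replace ps i q) j ≡ lookup⁺ ps j
  lookup⁺-replace-≢ (_ ∷ ps) {zero}  {_} {zero}  j≢i = contradiction refl j≢i
  lookup⁺-replace-≢ (_ ∷ ps) {zero}  {_} {suc j} j≢i = refl
  lookup⁺-replace-≢ (_ ∷ ps) {suc i} {_} {zero}  j≢i = refl
  lookup⁺-replace-≢ (_ ∷ ps) {suc i} {_} {suc j} j≢i = lookup⁺-replace-≢ ps (j≢i ∘ cong suc)

module _ {n : ℕ} {B : Fin n → Set} where

  infixl 6 _[_≔_]

  _[_≔_] : (∀ j → B j) → ∀ j → B j → ∀ j → B j
  (f [ j ≔ y ]) k with k Fin.≟ j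
  ... | yes refl = y
  ... | no  _    = f k

  ≔-≡ : ∀ f j y → (f [ j ≔ y ]) j ≡ y
  ≔-≡ f j y with j Fin.≟ j
  ... | yes refl = refl
  ... | no  j≢j  = contradiction refl j≢j

  ≔-≢ : ∀ f j y {k} → k ≢ j → (f [ j ≔ y ]) k ≡ f k
  ≔-≢ f j y {k} k≢j with k Fin.≟ j
  ... | yes k≡j = contradiction k≡j k≢j
  ... | no  _   = refl

-- Moves between global states whose channels other than the distinguished one are empty.

module Dynamics (P : Protocol) (β : Protocol.Edge P) (line : Line (Protocol.graph P) β) where
  open Protocol P
  open Line line

  Event : Node → Set
  Event = Action graph M

  Write : M β → Rel CompositeState 0ℓ
  Write b T T′ = stateOf T (tail β) ─[ send β b ]→ stateOf T′ (tail β) ×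
    (∀ j → j ≢ tail β → stateOf T′ j ≡ stateOf T j)

  Read : M β → Rel CompositeState 0ℓ
  Read b T T′ = stateOf T (head β) ─[ recv β b ]→ stateOf T′ (head β) ×
    (∀ j → j ≢ head β → stateOf T′ j ≡ stateOf T j)

  -- A send followed at once by its reception. The channel is empty before and after, so a relation
  -- between composite states is enough.
  Rendezvous : Rel CompositeState 0ℓ
  Rendezvous T T′ = ∃ λ ξ → ξ ≢ β × (∃ λ b →
    stateOf T (tail ξ) ─[ send ξ b ]→ stateOf T′ (tail ξ) ×
    stateOf T (head ξ) ─[ recv ξ b ]→ stateOf T′ (head ξ)) ×
    (∀ j → j ≢ tail ξ → j ≢ head ξ → stateOf T′ j ≡ stateOf T j)

  Write? : ∀ b → Decidable (Write b)
  Write? b T T′ = T? _ ×-dec Fin.all? λ j → ¬? (j Fin.≟ _) →-dec (_ Fin.≟ _)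

  Read? : ∀ b → Decidable (Read b)
  Read? b T T′ = T? _ ×-dec Fin.all? λ j → ¬? (j Fin.≟ _) →-dec (_ Fin.≟ _)

  Rendezvous? : Decidable Rendezvous
  Rendezvous? T T′ = Fin.any? λ ξ → ¬? (ξ Fin.≟ β) ×-dec
    Fin.any? (λ b → T? _ ×-dec T? _) ×-dec
    Fin.all? λ j → ¬? (j Fin.≟ _) →-dec ¬? (j Fin.≟ _) →-dec (_ Fin.≟ _)

  finite-CompositeState : Finite CompositeState
  finite-CompositeState = finite-All-Fin #states

  infix 4 _≟_
  _≟_ : DecidableEquality CompositeState
  S ≟ S′ = map′ lookup⁺-ext (λ { refl _ → refl }) (Fin.all? λ j → stateOf S j Fin.≟ stateOf S′ j)

  -- Writes on `β` are left out of `_↝_` on purpose: the remaining moves can only shorten the word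
  -- on `β`.
  open Consumption finite-CompositeState _≟_ Rendezvous? Read? public

  empty : ChannelContent
  empty = lookup⁻ λ _ → []

  only : List (M β) → ChannelContent
  only x = replace empty β x

  contentOf-only-β : ∀ x → contentOf (only x) β ≡ x
  contentOf-only-β x = lookup⁺-replace empty β x

  only-empty : ∀ x → EmptyExcept β (only x)
  only-empty x ξ ξ≢β = trans (lookup⁺-replace-≢ empty ξ≢β)
    (lookup⁺∘lookup⁻ {P = List ∘ Fin} {xs = #messages} (λ _ → []) ξ)

  only-unique : ∀ {C} → EmptyExcept β C → C ≡ only (contentOf C β)
  only-unique {C} none = lookup⁺-ext eq
    where
    eq : ∀ ξ → contentOf C ξ ≡ contentOf (only (contentOf C β)) ξ
    eq ξ with ξ Fin.≟ β
    ... | yes refl = sym (contentOf-only-β _)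
    ... | no  ξ≢β  = trans (none ξ ξ≢β) (sym (only-empty _ ξ ξ≢β))

  only-agree : ∀ x y ξ → ξ ≢ β → contentOf (only x) ξ ≡ contentOf (only y) ξ
  only-agree x y ξ ξ≢β = trans (only-empty x ξ ξ≢β) (sym (only-empty y ξ ξ≢β))

  write⇒⊢ : ∀ {b T T′ x} → Write b T T′ → (T , only x) ⊢ (T′ , only (x ∷ʳ b))
  write⇒⊢ {b} {x = x} (t , same) = send-step β b t same
    (trans (contentOf-only-β _) (cong (_∷ʳ b) (sym (contentOf-only-β x)))) (only-agree _ _)

  ↝⇒⊢* : ∀ {T T′ x x′} → (T , x) ↝ (T′ , x′) → (T , only x) ⊢* (T′ , only x′)
  ↝⇒⊢* (read {b = b} (t , same)) = recv-step β b t same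
    (trans (contentOf-only-β _) (cong (b ∷_) (sym (contentOf-only-β _)))) (only-agree _ _) ◅ ε
  ↝⇒⊢* {T} {T′} {x} (silent (ξ , ξ≢β , (b , s , r) , same)) =
    send-step {S′ = T₁} {C′ = C₁} ξ b
      (subst (stateOf T (tail ξ) ─[ send ξ b ]→_) (sym (lookup⁺-replace T _ _)) s)
      (λ _ → lookup⁺-replace-≢ T)
      (trans (lookup⁺-replace (only x) ξ _) (cong (_∷ʳ b) (sym (only-empty x ξ ξ≢β))))
      (λ _ → lookup⁺-replace-≢ (only x))
    ◅ recv-step ξ b
      (subst (_─[ recv ξ b ]→ stateOf T′ (head ξ)) (sym (lookup⁺-replace-≢ T (head≢tail ξ≢β))) r)
      others
      (trans (lookup⁺-replace (only x) ξ _) (cong (b ∷_) (sym (only-empty x ξ ξ≢β))))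
      (λ _ → sym ∘ lookup⁺-replace-≢ (only x))
    ◅ ε
    where
    -- The state between send and reception: only the sender has moved, and `b` is alone on `ξ`.
    T₁ = replace T (tail ξ) (stateOf T′ (tail ξ))
    C₁ = replace (only x) ξ (b ∷ [])

    others : ∀ j → j ≢ head ξ → stateOf T′ j ≡ stateOf T₁ j
    others j j≢head with j Fin.≟ tail ξ
    ... | yes refl   = sym (lookup⁺-replace T _ _)
    ... | no  j≢tail = trans (same j j≢tail j≢head) (sym (lookup⁺-replace-≢ T j≢tail))

  ↝*⇒⊢* : ∀ {T T′ x x′} → (T , x) ↝* (T′ , x′) → (T , only x) ⊢* (T′ , only x′)
  ↝*⇒⊢* = kleisliStar (λ (T , x) → T , only x) ↝⇒⊢*

  -- Local runs of a machine and the messages in them.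

  data Run {j} : K j → List (Event j) → K j → Set where
    []  : ∀ {p} → Run p [] p
    _∷_ : ∀ {p q r a as} → p ─[ a ]→ q → Run q as r → Run p (a ∷ as) r

  run-[] : ∀ {j} {p q : K j} → Run p [] q → p ≡ q
  run-[] [] = refl

  run-∷ʳ : ∀ {j as a} {p q r : K j} → Run p as q → q ─[ a ]→ r → Run p (as ∷ʳ a) r
  run-∷ʳ []       t = t ∷ []
  run-∷ʳ (u ∷ us) t = u ∷ run-∷ʳ us t

  -- At most one letter, as a list for use with `concatMap`. Events of every machine are allowed, so
  -- that statements about lags need no condition on the node.
  sent : ∀ ξ {j} → Event j → List (M ξ)
  sent ξ (send η b) with η Fin.≟ ξ
  ... | yes refl = b ∷ []
  ... | no  _    = []
  sent ξ (recv η b) = []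

  received : ∀ ξ {j} → Event j → List (M ξ)
  received ξ (send η b) = []
  received ξ (recv η b) with η Fin.≟ ξ
  ... | yes refl = b ∷ []
  ... | no  _    = []

  sent-≡ : ∀ ξ b → sent ξ (send ξ b) ≡ b ∷ []
  sent-≡ ξ b with ξ Fin.≟ ξ
  ... | yes refl = refl
  ... | no  ξ≢ξ  = contradiction refl ξ≢ξ

  sent-≢ : ∀ {ξ η} b → ξ ≢ η → sent ξ (send η b) ≡ []
  sent-≢ {ξ} {η} b ξ≢η with η Fin.≟ ξ
  ... | yes refl = contradiction refl ξ≢η
  ... | no  _    = refl

  received-≡ : ∀ ξ b → received ξ (recv ξ b) ≡ b ∷ []
  received-≡ ξ b with ξ Fin.≟ ξ
  ... | yes refl = refl
  ... | no  ξ≢ξ  = contradiction refl ξ≢ξ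

  received-≢ : ∀ {ξ η} b → ξ ≢ η → received ξ (recv η b) ≡ []
  received-≢ {ξ} {η} b ξ≢η with η Fin.≟ ξ
  ... | yes refl = contradiction refl ξ≢η
  ... | no  _    = refl

  sends : ∀ ξ {j} → List (Event j) → List (M ξ)
  sends ξ = concatMap (sent ξ)

  receives : ∀ ξ {j} → List (Event j) → List (M ξ)
  receives ξ = concatMap (received ξ)

  -- The node is a free index with an equation, since on the cycle one node is both the head of an
  -- edge and the tail of the next.
  sendAt : ∀ ξ {j} → tail ξ ≡ j → M ξ → Event j
  sendAt ξ refl = send ξ

  recvAt : ∀ ξ {j} → head ξ ≡ j → M ξ → Event j
  recvAt ξ refl = recv ξ

  sent-recvAt : ∀ ξ ζ {j} (h : head ζ ≡ j) b → sent ξ (recvAt ζ h b) ≡ []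
  sent-recvAt ξ ζ refl b = refl

  sends-recvAt : ∀ ξ ζ {j} (h : head ζ ≡ j) bs as → sends ξ (map (recvAt ζ h) bs ++ as) ≡ sends ξ as
  sends-recvAt ξ ζ h []       as = refl
  sends-recvAt ξ ζ h (b ∷ bs) as = cong₂ _++_ (sent-recvAt ξ ζ h b) (sends-recvAt ξ ζ h bs as)

  -- On a cycle each node has just one incoming and one outgoing edge.
  event-view : ∀ {j ζ ξ} (h : head ζ ≡ j) (t : tail ξ ≡ j) (a : Event j) →
    (∃ λ c → a ≡ recvAt ζ h c) ⊎ (∃ λ b → a ≡ sendAt ξ t b)
  event-view h t (send η b) with refl ← tail-injective t | refl ← t = inj₂ (b , refl)
  event-view h t (recv η c) with refl ← head-injective h | refl ← h = inj₁ (c , refl)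

  module _ {j : Node} {ζ ξ : Edge} (h : head ζ ≡ j) (t : tail ξ ≡ j) where

    -- Cuts the events before the first send. The trailing `++ []` brings the case without sends
    -- into the form that `Drain` expects.
    leading-receives : (as : List (Event j)) → ∃ λ cs →
      as ≡ map (recvAt ζ h) cs ++ [] ⊎ (∃₂ λ b rest → as ≡ map (recvAt ζ h) cs ++ sendAt ξ t b ∷ rest)
    leading-receives [] = [] , inj₁ refl
    leading-receives (a ∷ as) with event-view h t a | leading-receives as
    ... | inj₂ (b , refl) | _ = [] , inj₂ (b , as , refl)
    ... | inj₁ (c , refl) | cs , inj₁ eq = c ∷ cs , inj₁ (cong (_ ∷_) eq)
    ... | inj₁ (c , refl) | cs , inj₂ (b , rest , eq) = c ∷ cs , inj₂ (b , rest , cong (_ ∷_) eq)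

  no-sends : ∀ ζ ξ (h : head ζ ≡ tail ξ) as → sends ξ as ≡ [] → ∃ λ cs → as ≡ map (recvAt ζ h) cs ++ []
  no-sends ζ ξ h as none with leading-receives h refl as
  ... | cs , inj₁ eq = cs , eq
  ... | cs , inj₂ (b , rest , refl)
    with () ← trans (sym (trans (sends-recvAt ξ ζ h cs _) (cong (_++ _) (sent-≡ ξ b)))) none

  -- Receives contribute nothing to `sends ξ`, so its first letter is that of the first send.
  first-send : ∀ ζ ξ (h : head ζ ≡ tail ξ) as {b bs} → sends ξ as ≡ b ∷ bs →
    ∃₂ λ cs rest → as ≡ map (recvAt ζ h) cs ++ send ξ b ∷ rest
  first-send ζ ξ h as some with leading-receives h refl as
  ... | cs , inj₁ refl with () ← trans (sym (sends-recvAt ξ ζ h cs [])) some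
  ... | cs , inj₂ (b , rest , refl)
    with refl ← trans (sym (trans (sends-recvAt ξ ζ h cs _) (cong (_++ _) (sent-≡ ξ b)))) some
    = cs , rest , refl

  -- Postponed events and the invariant of rescheduling.

  Lag : Set
  Lag = ∀ j → List (Event j)

  module _ {X : Set} (f : ∀ {j} → Event j → List X) where

    concatMap-drop : ∀ (L : Lag) {j a rest} → L j ≡ a ∷ rest → f a ≡ [] →
      ∀ k → concatMap f ((L [ j ≔ rest ]) k) ≡ concatMap f (L k)
    concatMap-drop L {j} {a} {rest} eq fa≡[] k with k Fin.≟ j
    ... | no  _    = refl
    ... | yes refl = sym (trans (cong (concatMap f) eq) (cong (_++ concatMap f rest) fa≡[]))

    concatMap-∷ʳ : ∀ (L : Lag) {j a} → concatMap f ((L [ j ≔ L j ∷ʳ a ]) j) ≡ concatMap f (L j) ++ f a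
    concatMap-∷ʳ L {j} {a} = begin
      concatMap f ((L [ j ≔ L j ∷ʳ a ]) j)  ≡⟨ cong (concatMap f) (≔-≡ L j (L j ∷ʳ a)) ⟩
      concatMap f (L j ∷ʳ a)                ≡⟨ concatMap-++ f (L j) (a ∷ []) ⟩
      concatMap f (L j) ++ f a ++ []        ≡⟨ cong (concatMap f (L j) ++_) (++-identityʳ (f a)) ⟩
      concatMap f (L j) ++ f a              ∎
      where open ≡-Reasoning

    concatMap-append : ∀ (L : Lag) {j a} → f a ≡ [] →
      ∀ k → concatMap f ((L [ j ≔ L j ∷ʳ a ]) k) ≡ concatMap f (L k)
    concatMap-append L {j} {a} fa≡[] k with k Fin.≟ j
    ... | no  _    = refl
    ... | yes refl = trans (concatMap-++ f (L j) (a ∷ []))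
                       (trans (cong (λ ys → concatMap f (L j) ++ ys ++ []) fa≡[]) (++-identityʳ _))

  Runs : CompositeState → Lag → CompositeState → Set
  Runs T L S = ∀ j → Run (stateOf T j) (L j) (stateOf S j)

  runs-drop : ∀ {T L S j a rest} → Runs T L S → L j ≡ a ∷ rest →
    ∃ λ q → stateOf T j ─[ a ]→ q × Runs (replace T j q) (L [ j ≔ rest ]) S
  runs-drop {L = L} {j = j} runs eq with L j | runs j
  runs-drop {T} {L} {S} {j} {a} {rest} runs refl | .(a ∷ rest) | _∷_ {q = q} t us = q , t , runs′
    where
    runs′ : Runs (replace T j q) (L [ j ≔ rest ]) S
    runs′ k with k Fin.≟ j
    ... | yes refl = subst (λ p → Run p rest _) (sym (lookup⁺-replace T j q)) us
    ... | no  k≢j  = subst (λ p → Run p (L k) _) (sym (lookup⁺-replace-≢ T k≢j)) (runs k)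

  runs-append : ∀ {T L S S′ j a} → Runs T L S → stateOf S j ─[ a ]→ stateOf S′ j →
    (∀ k → k ≢ j → stateOf S′ k ≡ stateOf S k) → Runs T (L [ j ≔ L j ∷ʳ a ]) S′
  runs-append {j = j} runs t same k with k Fin.≟ j
  ... | yes refl = run-∷ʳ (runs j) t
  ... | no  k≢j  = subst (Run _ _) (sym (same k k≢j)) (runs k)

  -- (S , C) is a global state of an actual execution; (T , x) is the state of
  -- a rescheduled one, with all channels but β empty, that still has to
  -- perform the events L.
  record Lagging (T : CompositeState) (x : List (M β)) (L : Lag) (S : CompositeState) (C : ChannelContent) : Set where
    field
      runs      : Runs T L S
      -- With `ξ` empty in the rescheduled state, the pending sends must supply both the pending
      -- receptions and the actual content.
      channel   : ∀ ξ → ξ ≢ β → sends ξ (L (tail ξ)) ≡ receives ξ (L (head ξ)) ++ contentOf C ξ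
      channel-β : x ≡ receives β (L (head β)) ++ contentOf C β
      -- Writes on `β` are never postponed.
      quiet     : sends β (L (tail β)) ≡ []

  open Lagging

  -- By `channel-β` the pending receptions on `β` form a prefix of `x`, so the first of them can be
  -- performed.
  lag-read : ∀ {T x L S C b rest} → Lagging T x L S C → L (head β) ≡ recv β b ∷ rest →
    ∃₂ λ q x′ → (T , x) ↝ (replace T (head β) q , x′) × Lagging (replace T (head β) q) x′ (L [ head β ≔ rest ]) S C
  lag-read {T} {x} {L} {S} {C} {b} {rest} lag eq =
    q , x′ , subst (λ x → (T , x) ↝ (replace T (head β) q , x′)) (sym x≡) (read (t′ , λ _ → lookup⁺-replace-≢ T)) ,
    record
      { runs      = runs′
      ; channel   = λ ξ ξ≢β → trans (sends-same ξ _) (trans (channel lag ξ ξ≢β)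
          (cong (_++ contentOf C ξ) (sym (concatMap-drop (received ξ) L eq (received-≢ b ξ≢β) _))))
      ; channel-β = cong (λ as → receives β as ++ contentOf C β) (sym (≔-≡ L (head β) rest))
      ; quiet     = trans (sends-same β _) (quiet lag)
      }
    where
    dropped = runs-drop {T} {L} {S} (runs lag) eq
    q = dropped .proj₁
    t = dropped .proj₂ .proj₁
    runs′ = dropped .proj₂ .proj₂
    t′ = subst (stateOf T (head β) ─[ recv β b ]→_) (sym (lookup⁺-replace T (head β) q)) t
    x′ = receives β rest ++ contentOf C β
    x≡ : x ≡ b ∷ x′
    x≡ = trans (channel-β lag) (cong (_++ contentOf C β)
           (trans (cong (receives β) eq) (cong (_++ receives β rest) (received-≡ β b))))
    sends-same : ∀ ξ k → sends ξ ((L [ head β ≔ rest ]) k) ≡ sends ξ (L k)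
    sends-same ξ = concatMap-drop (sent ξ) L eq refl

  -- The rescheduled channel `ζ` is empty, so the letter awaited at its head is the first that its
  -- tail has still to send.
  lag-demand : ∀ {T x L S C ζ b rest} → Lagging T x L S C → ζ ≢ β → L (head ζ) ≡ recv ζ b ∷ rest →
    sends ζ (L (tail ζ)) ≡ b ∷ receives ζ rest ++ contentOf C ζ
  lag-demand {L = L} {C = C} {ζ = ζ} {b = b} {rest = rest} lag ζ≢β eq = begin
    sends ζ (L (tail ζ))                           ≡⟨ channel lag ζ ζ≢β ⟩
    receives ζ (L (head ζ)) ++ contentOf C ζ       ≡⟨ cong (λ bs → receives ζ bs ++ contentOf C ζ) eq ⟩
    receives ζ (recv ζ b ∷ rest) ++ contentOf C ζ  ≡⟨ cong (λ c → (c ++ receives ζ rest) ++ contentOf C ζ) (received-≡ ζ b) ⟩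
    b ∷ receives ζ rest ++ contentOf C ζ           ∎
    where open ≡-Reasoning

  -- The letter `b` cancels on both sides of the balance of `ζ`. The sender's transition and the
  -- unchanged states are returned as well, for deriving membership in `V`.
  lag-rendezvous : ∀ {T x L S C ζ b as bs} → Lagging T x L S C → ζ ≢ β →
    L (tail ζ) ≡ send ζ b ∷ as → L (head ζ) ≡ recv ζ b ∷ bs →
    ∃ λ T′ → (T , x) ↝ (T′ , x) × Lagging T′ x (L [ tail ζ ≔ as ] [ head ζ ≔ bs ]) S C ×
      stateOf T (tail ζ) ─[ send ζ b ]→ stateOf T′ (tail ζ) ×
      (∀ k → k ≢ tail ζ → k ≢ head ζ → stateOf T′ k ≡ stateOf T k)
  lag-rendezvous {T} {x} {L} {S} {C} {ζ} {b} {as} {bs} lag ζ≢β eqₜ eqₕ =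
    T₂ , silent (ζ , ζ≢β , (b , t′ , u′) , same) , lag′ , t′ , same
    where
    L₁ = L [ tail ζ ≔ as ]
    L₂ = L₁ [ head ζ ≔ bs ]
    dropped₁ = runs-drop {T} {L} {S} (runs lag) eqₜ
    q₁ = dropped₁ .proj₁
    t  = dropped₁ .proj₂ .proj₁
    T₁ = replace T (tail ζ) q₁
    eqₕ₁ : L₁ (head ζ) ≡ recv ζ b ∷ bs
    eqₕ₁ = trans (≔-≢ L (tail ζ) as (head≢tail ζ≢β)) eqₕ
    dropped₂ = runs-drop {T₁} {L₁} {S} (dropped₁ .proj₂ .proj₂) eqₕ₁
    q₂ = dropped₂ .proj₁
    u  = dropped₂ .proj₂ .proj₁
    T₂ = replace T₁ (head ζ) q₂

    t′ : stateOf T (tail ζ) ─[ send ζ b ]→ stateOf T₂ (tail ζ)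
    t′ = subst (stateOf T (tail ζ) ─[ send ζ b ]→_)
           (sym (trans (lookup⁺-replace-≢ T₁ (head≢tail ζ≢β ∘ sym)) (lookup⁺-replace T (tail ζ) q₁))) t

    u′ : stateOf T (head ζ) ─[ recv ζ b ]→ stateOf T₂ (head ζ)
    u′ = subst₂ (_─[ recv ζ b ]→_)
           (lookup⁺-replace-≢ T (head≢tail ζ≢β)) (sym (lookup⁺-replace T₁ (head ζ) q₂)) u

    same : ∀ k → k ≢ tail ζ → k ≢ head ζ → stateOf T₂ k ≡ stateOf T k
    same k k≢t k≢h = trans (lookup⁺-replace-≢ T₁ k≢h) (lookup⁺-replace-≢ T k≢t)

    sends-same : ∀ {ξ} → ξ ≢ ζ → ∀ k → sends ξ (L₂ k) ≡ sends ξ (L k)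
    sends-same {ξ} ξ≢ζ k = trans (concatMap-drop (sent ξ) L₁ eqₕ₁ refl k)
                             (concatMap-drop (sent ξ) L eqₜ (sent-≢ b ξ≢ζ) k)

    receives-same : ∀ {ξ} → ξ ≢ ζ → ∀ k → receives ξ (L₂ k) ≡ receives ξ (L k)
    receives-same {ξ} ξ≢ζ k = trans (concatMap-drop (received ξ) L₁ eqₕ₁ (received-≢ b ξ≢ζ) k)
                                (concatMap-drop (received ξ) L eqₜ refl k)

    channel-ζ : sends ζ (L₂ (tail ζ)) ≡ receives ζ (L₂ (head ζ)) ++ contentOf C ζ
    channel-ζ = begin
      sends ζ (L₂ (tail ζ))   ≡⟨ cong (sends ζ) (trans (≔-≢ L₁ (head ζ) bs (head≢tail ζ≢β ∘ sym)) (≔-≡ L (tail ζ) as)) ⟩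
      sends ζ as              ≡⟨ ∷-injectiveʳ cancelled ⟩
      receives ζ bs ++ contentOf C ζ           ≡⟨ cong (λ bs → receives ζ bs ++ contentOf C ζ) (≔-≡ L₁ (head ζ) bs) ⟨
      receives ζ (L₂ (head ζ)) ++ contentOf C ζ ∎
      where
      open ≡-Reasoning
      cancelled : b ∷ sends ζ as ≡ b ∷ receives ζ bs ++ contentOf C ζ
      cancelled = begin
        b ∷ sends ζ as                             ≡⟨ cong (_++ sends ζ as) (sent-≡ ζ b) ⟨
        sends ζ (send ζ b ∷ as)                    ≡⟨ cong (sends ζ) eqₜ ⟨
        sends ζ (L (tail ζ))                       ≡⟨ lag-demand lag ζ≢β eqₕ ⟩
        b ∷ receives ζ bs ++ contentOf C ζ         ∎

    channel′ : ∀ ξ → ξ ≢ β → sends ξ (L₂ (tail ξ)) ≡ receives ξ (L₂ (head ξ)) ++ contentOf C ξ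
    channel′ ξ ξ≢β with ξ Fin.≟ ζ
    ... | yes refl = channel-ζ
    ... | no  ξ≢ζ  = trans (sends-same ξ≢ζ _) (trans (channel lag ξ ξ≢β)
                       (cong (_++ contentOf C ξ) (sym (receives-same ξ≢ζ _))))

    lag′ : Lagging T₂ x L₂ S C
    lag′ = record
      { runs      = dropped₂ .proj₂ .proj₂
      ; channel   = channel′
      ; channel-β = trans (channel-β lag) (cong (_++ contentOf C β) (sym (receives-same (ζ≢β ∘ sym) _)))
      ; quiet     = trans (sends-same (ζ≢β ∘ sym) _) (quiet lag)
      }

  -- The send is only postponed: `b` is added at the end of both sides of the balance of `ξ`.
  lag-send : ∀ {T x L S S′ C C′ ξ b} → Lagging T x L S C → ξ ≢ β →
    stateOf S (tail ξ) ─[ send ξ b ]→ stateOf S′ (tail ξ) →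
    (∀ j → j ≢ tail ξ → stateOf S′ j ≡ stateOf S j) →
    contentOf C′ ξ ≡ contentOf C ξ ∷ʳ b →
    (∀ η → η ≢ ξ → contentOf C′ η ≡ contentOf C η) →
    Lagging T x (L [ tail ξ ≔ L (tail ξ) ∷ʳ send ξ b ]) S′ C′
  lag-send {T} {x} {L} {S} {S′} {C} {C′} {ξ} {b} lag ξ≢β t same C′ξ C′η = record
    { runs      = runs-append {T} {L} {S} {S′} (runs lag) t same
    ; channel   = channel′
    ; channel-β = trans (channel-β lag)
        (cong₂ _++_ (sym (receives-same β _)) (sym (C′η β (ξ≢β ∘ sym))))
    ; quiet     = trans (concatMap-append (sent β) L (sent-≢ b (ξ≢β ∘ sym)) _) (quiet lag)
    }
    where
    L′ = L [ tail ξ ≔ L (tail ξ) ∷ʳ send ξ b ]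

    receives-same : ∀ η k → receives η (L′ k) ≡ receives η (L k)
    receives-same η = concatMap-append (received η) L refl

    channel′ : ∀ η → η ≢ β → sends η (L′ (tail η)) ≡ receives η (L′ (head η)) ++ contentOf C′ η
    channel′ η η≢β with η Fin.≟ ξ
    ... | no  η≢ξ  = trans (concatMap-append (sent η) L (sent-≢ b η≢ξ) _) (trans (channel lag η η≢β)
                       (cong₂ _++_ (sym (receives-same η _)) (sym (C′η η η≢ξ))))
    ... | yes refl = begin
      sends ξ (L′ (tail ξ))                            ≡⟨ concatMap-∷ʳ (sent ξ) L ⟩
      sends ξ (L (tail ξ)) ++ sent ξ (send ξ b)        ≡⟨ cong₂ _++_ (channel lag ξ ξ≢β) (sent-≡ ξ b) ⟩
      (receives ξ (L (head ξ)) ++ contentOf C ξ) ∷ʳ b  ≡⟨ ++-assoc (receives ξ (L (head ξ))) _ _ ⟩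
      receives ξ (L (head ξ)) ++ contentOf C ξ ∷ʳ b    ≡⟨ cong₂ _++_ (receives-same ξ _) C′ξ ⟨
      receives ξ (L′ (head ξ)) ++ contentOf C′ ξ       ∎
      where open ≡-Reasoning

  -- The letter passes from the channel to the pending receptions, so their concatenation is
  -- unchanged, on `β` as elsewhere.
  lag-recv : ∀ {T x L S S′ C C′ ξ b} → Lagging T x L S C →
    stateOf S (head ξ) ─[ recv ξ b ]→ stateOf S′ (head ξ) →
    (∀ j → j ≢ head ξ → stateOf S′ j ≡ stateOf S j) →
    contentOf C ξ ≡ b ∷ contentOf C′ ξ →
    (∀ η → η ≢ ξ → contentOf C′ η ≡ contentOf C η) →
    Lagging T x (L [ head ξ ≔ L (head ξ) ∷ʳ recv ξ b ]) S′ C′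
  lag-recv {T} {x} {L} {S} {S′} {C} {C′} {ξ} {b} lag t same Cξ C′η = record
    { runs      = runs-append {T} {L} {S} {S′} (runs lag) t same
    ; channel   = λ η η≢β → trans (sends-same η _) (trans (channel lag η η≢β) (sym (pending η)))
    ; channel-β = trans (channel-β lag) (sym (pending β))
    ; quiet     = trans (sends-same β _) (quiet lag)
    }
    where
    L′ = L [ head ξ ≔ L (head ξ) ∷ʳ recv ξ b ]

    sends-same : ∀ η k → sends η (L′ k) ≡ sends η (L k)
    sends-same η = concatMap-append (sent η) L refl

    pending : ∀ η → receives η (L′ (head η)) ++ contentOf C′ η ≡ receives η (L (head η)) ++ contentOf C η
    pending η with η Fin.≟ ξ
    ... | no  η≢ξ  = cong₂ _++_ (concatMap-append (received η) L (received-≢ b η≢ξ) _) (C′η η η≢ξ)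
    ... | yes refl = begin
      receives ξ (L′ (head ξ)) ++ contentOf C′ ξ       ≡⟨ cong (_++ contentOf C′ ξ) (concatMap-∷ʳ (received ξ) L) ⟩
      (receives ξ (L (head ξ)) ++ received ξ (recv ξ b)) ++ contentOf C′ ξ
        ≡⟨ cong (λ c → (receives ξ (L (head ξ)) ++ c) ++ contentOf C′ ξ) (received-≡ ξ b) ⟩
      (receives ξ (L (head ξ)) ∷ʳ b) ++ contentOf C′ ξ ≡⟨ ++-assoc (receives ξ (L (head ξ))) _ _ ⟩
      receives ξ (L (head ξ)) ++ b ∷ contentOf C′ ξ    ≡⟨ cong (receives ξ (L (head ξ)) ++_) Cξ ⟨
      receives ξ (L (head ξ)) ++ contentOf C ξ         ∎
      where open ≡-Reasoning

  lag-done : ∀ {T x L S C} → Lagging T x L S C → (∀ j → L j ≡ []) → (T , x) ≡ (S , contentOf C β)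
  lag-done {T} {x} {L} {S} {C} lag done = cong₂ _,_
    (lookup⁺-ext λ j → run-[] (subst (λ as → Run _ as _) (done j) (runs lag j)))
    (trans (channel-β lag) (cong (λ as → receives β as ++ contentOf C β) (done (head β))))

  -- Performing postponed events on demand.

  module Draining (V : StateSets)
    (send⇒V : ∀ ξ (b : M ξ) (p q : K (tail ξ)) → p ─[ send ξ b ]→ q → q ∈ V (tail ξ)) where

    -- Only machines up to the rank of `j` are touched. Those other than `j` stop right after a
    -- send; `j` may stop after a receive and is excepted from `keeps-V`.
    record Drained (T : CompositeState) (x : List (M β)) (L : Lag) (S : CompositeState) (C : ChannelContent)
      (j : Node) (rest : List (Event j)) : Set where
      field
        {T′}    : CompositeState
        {x′}    : List (M β)
        {L′}    : Lag
        path    : (T , x) ↝* (T′ , x′)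
        lag     : Lagging T′ x′ L′ S C
        at      : L′ j ≡ rest
        above   : ∀ k → rank j < rank k → L′ k ≡ L k
        keeps-V : ∀ k → k ≢ j → stateOf T k ∈ V k → stateOf T′ k ∈ V k

    open Drained

    drained-refl : ∀ {T x L S C j rest} → Lagging T x L S C → L j ≡ rest → Drained T x L S C j rest
    drained-refl lag₀ eq = record
      { path = ε ; lag = lag₀ ; at = eq ; above = λ _ _ → refl ; keeps-V = λ _ _ → id }

    drained-trans : ∀ {T x L S C j as bs} (D : Drained T x L S C j as) →
      Drained (T′ D) (x′ D) (L′ D) S C j bs → Drained T x L S C j bs
    drained-trans D E = record
      { path    = path D ◅◅ path E
      ; lag     = lag E
      ; at      = at E
      ; above   = λ k j<k → trans (above E k j<k) (above D k j<k)
      ; keeps-V = λ k k≢j → keeps-V E k k≢j ∘ keeps-V D k k≢j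
      }

    Drain : ℕ → Set
    Drain n = ∀ {j} ζ (h : head ζ ≡ j) → rank j ≡ n → ∀ bs {rest T x L S C} →
      Lagging T x L S C → L j ≡ map (recvAt ζ h) bs ++ rest → Drained T x L S C j rest

    drain-read : ∀ {b rest T x L S C} → Lagging T x L S C →
      L (head β) ≡ recv β b ∷ rest → Drained T x L S C (head β) rest
    drain-read {rest = rest} {T} {L = L} lag₀ eq with q , x₁ , step , lag₁ ← lag-read lag₀ eq = record
      { path    = step ◅ ε
      ; lag     = lag₁
      ; at      = ≔-≡ L (head β) rest
      ; above   = λ k j<k → ≔-≢ L (head β) rest λ { refl → <⇒≢ j<k refl }
      ; keeps-V = λ k k≢j → subst (_∈ V k) (sym (lookup⁺-replace-≢ T k≢j))
      }

    -- The message to be received is that of the first pending send of the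
    -- previous machine; the receives that precede this send are drained first.
    drain-rendezvous : ∀ {ζ} → ζ ≢ β → Drain (rank (tail ζ)) → ∀ {b rest T x L S C} → Lagging T x L S C →
      L (head ζ) ≡ recv ζ b ∷ rest → Drained T x L S C (head ζ) rest
    drain-rendezvous {ζ} ζ≢β drain-tail {b} {rest} {T} {x} {L} {S} {C} lag₀ eq
      with η , head-η ← incoming (tail ζ)
      with cs , as , split ← first-send η ζ head-η (L (tail ζ)) (lag-demand lag₀ ζ≢β eq)
      with D ← drain-tail η head-η refl cs lag₀ split
      with T₂ , step , lag₂ , t , same ← lag-rendezvous (lag D) ζ≢β (at D)
             (trans (above D (head ζ) (≤-reflexive (sym (rank-head ζ≢β)))) eq)
      = record
      { path    = path D ◅◅ step ◅ ε
      ; lag     = lag₂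
      ; at      = ≔-≡ (L′ D [ tail ζ ≔ as ]) (head ζ) rest
      ; above   = above′
      ; keeps-V = keeps-V′
      }
      where
      above′ : ∀ k → rank (head ζ) < rank k → (L′ D [ tail ζ ≔ as ] [ head ζ ≔ rest ]) k ≡ L k
      above′ k j<k =
        trans (≔-≢ (L′ D [ tail ζ ≔ as ]) (head ζ) rest λ { refl → <⇒≢ j<k refl })
        (trans (≔-≢ (L′ D) (tail ζ) as λ { refl → <⇒≢ tail<k refl })
        (above D k tail<k))
        where
        tail<k : rank (tail ζ) < rank k
        tail<k = <-trans (≤-reflexive (sym (rank-head ζ≢β))) j<k

      keeps-V′ : ∀ k → k ≢ head ζ → stateOf T k ∈ V k → stateOf T₂ k ∈ V k
      keeps-V′ k k≢head k∈V with k Fin.≟ tail ζ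
      -- The rendezvous has left the sender right after a send.
      ... | yes refl   = send⇒V ζ b _ _ t
      ... | no  k≢tail = subst (_∈ V k) (sym (same k k≢tail k≢head)) (keeps-V D k k≢tail k∈V)

    -- Recursion on the rank, and within a rank on the number of receives. A receive on `ζ ≢ β`
    -- calls for draining one rank lower; at rank 0 the edge can only be `β`, whose letters are at
    -- hand.
    drain : ∀ n → Drain n

    drain-one : ∀ n ζ → rank (head ζ) ≡ n → ∀ {b rest T x L S C} → Lagging T x L S C →
      L (head ζ) ≡ recv ζ b ∷ rest → Drained T x L S C (head ζ) rest
    drain-one n ζ rank-j lag₀ eq with ζ Fin.≟ β
    drain-one n       ζ rank-j lag₀ eq | yes refl = drain-read lag₀ eq
    drain-one zero    ζ rank-j lag₀ eq | no ζ≢β =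
      contradiction (trans (sym rank-j) (rank-head ζ≢β)) 0≢1+n
    drain-one (suc n) ζ rank-j lag₀ eq | no ζ≢β = drain-rendezvous ζ≢β
      (subst Drain (sym (suc-injective (trans (sym (rank-head ζ≢β)) rank-j))) (drain n)) lag₀ eq

    drain n ζ h rank-j [] lag₀ eq = drained-refl lag₀ eq
    drain n ζ refl rank-j (b ∷ bs) lag₀ eq =
      let D = drain-one n ζ rank-j lag₀ eq
      in drained-trans D (drain n ζ refl rank-j bs (lag D) (at D))

    -- Descends along the line. If all machines of higher rank are settled, nothing is demanded from
    -- the machine of rank `n` and its outgoing channel ends empty, so it has only receives pending;
    -- draining these settles it too.
    drain-below : ∀ n {j} → rank j ≡ n → ∀ {T x L S C} → EmptyExcept β C → Lagging T x L S C →
      (∀ k → n < rank k → L k ≡ []) → (T , x) ↝* (S , contentOf C β)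
    drain-below n {j} rank-j {T} {x} {L} {S} {C} none lag₀ settled
      with ξ , refl ← outgoing j | ζ , h ← incoming j = finish n refl
      where
      nothing-sent : sends ξ (L (tail ξ)) ≡ []
      nothing-sent with ξ Fin.≟ β
      ... | yes refl = quiet lag₀
      ... | no  ξ≢β  = trans (channel lag₀ ξ ξ≢β) (cong₂ _++_
        (cong (receives ξ) (settled (head ξ)
          (≤-reflexive (sym (trans (rank-head ξ≢β) (cong suc rank-j))))))
        (none ξ ξ≢β))

      only-receives = no-sends ζ ξ h (L (tail ξ)) nothing-sent

      D : Drained T x L S C (tail ξ) []
      D = drain n ζ h rank-j (only-receives .proj₁) lag₀ (only-receives .proj₂)

      settled′ : ∀ k → n ≤ rank k → L′ D k ≡ []
      settled′ k n≤k with m≤n⇒m<n∨m≡n n≤k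
      ... | inj₁ n<k = trans (above D k (subst (_< rank k) (sym rank-j) n<k)) (settled k n<k)
      ... | inj₂ n≡k with refl ← rank-injective {k} {tail ξ} (trans (sym n≡k) (sym rank-j)) = at D

      -- Matching on a copy of `n` keeps the facts above common to both cases.
      finish : ∀ l → l ≡ n → (T , x) ↝* (S , contentOf C β)
      finish zero refl =
        subst ((T , x) ↝*_) (lag-done (lag D) λ k → settled′ k z≤n) (path D)
      finish (suc l) refl = path D ◅◅ drain-below l {tail ζ} rank-tail none (lag D) settled′
        where
        ζ≢β : ζ ≢ β
        ζ≢β refl = 0≢1+n (trans (sym rank-head-β) (trans (cong rank h) rank-j))
        rank-tail : rank (tail ζ) ≡ l
        rank-tail = suc-injective (trans (sym (rank-head ζ≢β)) (trans (cong rank h) rank-j))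

    -- The descent starts at `tail β`, which has the largest rank, so no machine needs to be settled
    -- beforehand.
    drain-all : ∀ {T x L S C} → EmptyExcept β C → Lagging T x L S C → (T , x) ↝* (S , contentOf C β)
    drain-all none lag₀ = drain-below _ refl none lag₀ λ k β<k → contradiction (rank≤tail-β k) (<⇒≱ β<k)

    InV : Pred CompositeState 0ℓ
    InV S = ∀ j → stateOf S j ∈ V j

    InV? : Unary.Decidable InV
    InV? S = Fin.all? λ j → stateOf S j ∈? V j

    -- The membership proof stored in `R` is irrelevant; decidability recovers a usable one.
    inV : (R : Restricted V) → InV (value R)
    inV (S , [ S∈V ]) = recompute (InV? S) S∈V

    finite-Restricted : Finite (Restricted V)
    finite-Restricted = finite-Refinement finite-CompositeState InV?

    -- The smallest extension and the decision of extendability.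

    module Extending (Q : Restricted V → MessageLanguage β) where

      Closure : CompositeState → MessageLanguage β
      Closure S y = ∃ λ R → ∃ λ x → x Unary.∈ Q R × (value R , x) ↝* (S , y)

      ReadClosed : Set
      ReadClosed = ∀ R → Closure (value R) ⊆ Q R

      -- Targets of writes are tested in `∏ V` only, since rescheduling makes every write end there.
      WriteClosed : Set
      WriteClosed = ∀ R S b → Write b S (value R) → Closure S ⊆ λ y → y ∷ʳ b Unary.∈ Q R

      -- A write on β is delayed until the writing machine has no pending
      -- receives: then all other machines are in V, and the write brings the
      -- last one into V.
      simulate : WriteClosed → ∀ R {x L S C S′ C′} → x Unary.∈ Q R → Lagging (value R) x L S C →
        (S , C) ⊢* (S′ , C′) → EmptyExcept β C′ → contentOf C′ β Unary.∈ Closure S′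
      simulate closed R x∈ lag₀ ε none = R , _ , x∈ , drain-all none lag₀
      simulate closed R x∈ lag₀ (recv-step ξ b t same Cξ C′η ◅ r) none =
        simulate closed R x∈ (lag-recv lag₀ t same Cξ C′η) r none
      simulate closed R x∈ lag₀ (send-step ξ b t same C′ξ C′η ◅ r) none with ξ Fin.≟ β
      ... | no ξ≢β = simulate closed R x∈ (lag-send lag₀ ξ≢β t same C′ξ C′η) r none
      simulate closed R {x} {L} {S₀} x∈ lag₀ (send-step {S′ = S₁} {C′ = C₁} ξ b t same C′ξ C′η ◅ r) none
        | yes refl
        with ζ , h ← incoming (tail β)
        with cs , eq ← no-sends ζ β h (L (tail β)) (quiet lag₀)
        with D ← drain _ ζ h refl cs lag₀ eq
        -- The word after the write belongs to the given family again, so `R₁` is the new origin and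
        -- the path so far can be forgotten.
        = simulate closed R₁ (closed R₁ (T′ D) b write (R , x , x∈ , path D)) lag₁ r none
        where
        T₁ : CompositeState
        T₁ = replace (T′ D) (tail β) (stateOf S₁ (tail β))

        caught-up : stateOf (T′ D) (tail β) ≡ stateOf S₀ (tail β)
        caught-up = run-[] (subst (λ as → Run _ as _) (at D) (runs (lag D) (tail β)))

        write : Write b (T′ D) T₁
        write = subst₂ (_─[ send β b ]→_) (sym caught-up) (sym (lookup⁺-replace (T′ D) (tail β) _)) t ,
          λ _ → lookup⁺-replace-≢ (T′ D)

        T₁∈V : InV T₁
        T₁∈V j with j Fin.≟ tail β
        ... | yes refl = send⇒V β b _ _ (write .proj₁)
        ... | no  j≢β  = subst (_∈ V j) (sym (write .proj₂ j j≢β)) (keeps-V D j j≢β (inV R j))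

        R₁ : Restricted V
        R₁ = T₁ , [ T₁∈V ]

        runs₁ : Runs T₁ (L′ D) S₁
        runs₁ j with j Fin.≟ tail β
        ... | yes refl = subst₂ (λ p as → Run p as _) (sym (lookup⁺-replace (T′ D) (tail β) _)) (sym (at D)) []
        ... | no  j≢β  = subst₂ (λ p q → Run p (L′ D j) q)
                           (sym (write .proj₂ j j≢β)) (sym (same j j≢β)) (runs (lag D) j)

        lag₁ : Lagging T₁ (x′ D ∷ʳ b) (L′ D) S₁ C₁
        lag₁ = record
          { runs      = runs₁
          ; channel   = λ η η≢β → trans (channel (lag D) η η≢β) (cong (_ ++_) (sym (C′η η η≢β)))
          ; channel-β = trans (cong (_∷ʳ b) (channel-β (lag D)))
              (trans (++-assoc (receives β (L′ D (head β))) _ _) (cong (_ ++_) (sym C′ξ)))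
          ; quiet     = quiet (lag D)
          }

      no-lag : ∀ S x → Lagging S x (λ _ → []) S (only x)
      no-lag S x = record
        { runs      = λ _ → []
        ; channel   = λ ξ ξ≢β → sym (only-empty x ξ ξ≢β)
        ; channel-β = sym (contentOf-only-β x)
        ; quiet     = refl
        }

      -- The path that put the word into the closure is prepended to the execution, so that the
      -- simulation starts in the given family with nothing postponed.
      closure-consistent : WriteClosed → Consistent β Closure
      closure-consistent closed {S} r none none′ (R , x , x∈ , path) =
        simulate closed R x∈ (no-lag (value R) x)
          (↝*⇒⊢* path ◅◅ subst (λ C → (S , C) ⊢* _) (only-unique none) r) none′

      closure-extension : ReadClosed → WriteClosed → IsConsistentExtension β V Q Closure
      closure-extension readClosed writeClosed =
        (λ R → readClosed R , λ x∈ → R , _ , x∈ , ε) , closure-consistent writeClosed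

      module _ {Q′ : CompositeState → MessageLanguage β} (extension : IsConsistentExtension β V Q Q′) where

        consistent-only : ∀ {S S′ x x′} → (S , only x) ⊢* (S′ , only x′) → x Unary.∈ Q′ S → x′ Unary.∈ Q′ S′
        consistent-only {S} {S′} {x} {x′} r x∈ = subst (Unary._∈ Q′ S′) (contentOf-only-β x′)
          (extension .proj₂ r (only-empty x) (only-empty x′) (subst (Unary._∈ Q′ S) (sym (contentOf-only-β x)) x∈))

        closure-smallest : ∀ S → Closure S ⊆ Q′ S
        closure-smallest S (R , x , x∈ , path) =
          consistent-only (↝*⇒⊢* path) (extension .proj₁ R .proj₂ x∈)

        -- Every extension contains the closure and agrees with `Q` on `∏ V`.
        extension⇒readClosed : ReadClosed
        extension⇒readClosed R = extension .proj₁ R .proj₁ ∘ closure-smallest (value R)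

        -- A write is a further step of the protocol, which consistency of the extension has to
        -- follow.
        extension⇒writeClosed : WriteClosed
        extension⇒writeClosed R S b write =
          extension .proj₁ R .proj₁ ∘ consistent-only (write⇒⊢ write ◅ ε) ∘ closure-smallest S

      module _ (regular : ∀ R → Regular (Q R)) where

        -- A finite union of residuals of the given regular sets.
        closure-regular : ∀ S → Regular (Closure S)
        closure-regular S =
          regular-∃ finite-Restricted λ R → regular-residual (regular R) (value R) S

        readClosed? : Dec ReadClosed
        readClosed? = ∀? finite-Restricted λ R → regular-⊆? (closure-regular (value R)) (regular R)

        writeClosed? : Dec WriteClosed
        writeClosed? = ∀? finite-Restricted λ R → ∀? finite-CompositeState λ S → Fin.all? λ b →
          Write? b S (value R) →-dec regular-⊆? (closure-regular S) (regular-∷ʳ b (regular R))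

theorem8p8 : (P : Protocol) → Cyclic P → let open Protocol P in
    (β : Edge) (V : StateSets) →
    (∀ j → h j ∈ V j) →
    (∀ ξ (b : M ξ) (p q : K (tail ξ)) → p ─[ send ξ b ]→ q → q ∈ V (tail ξ)) →
    (Q : Restricted V → MessageLanguage β) → (∀ S → Regular (Q S)) →
    Dec (Extendable β V Q) ×
    (Extendable β V Q →
    ∃ λ (Q̂ : CompositeState → MessageLanguage β) →
    IsSmallestConsistentExtension β V Q Q̂ × (∀ S → Regular (Q̂ S)))
theorem8p8 P cyclic β V _ send⇒V Q regular =
  -- Extendability is equivalent to the two closure conditions, which amount to finitely many
  -- inclusions of regular sets.
  map′
    (λ (readClosed , writeClosed) → Closure , closure-extension readClosed writeClosed)
    (λ (_ , extension) → extension⇒readClosed extension , extension⇒writeClosed extension)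
    (readClosed? regular ×-dec writeClosed? regular) ,
  -- Any extension at all yields both conditions, and these make the closure an extension.
  λ (_ , extension) → Closure ,
    (closure-extension (extension⇒readClosed extension) (extension⇒writeClosed extension) ,
     λ _ → closure-smallest) ,
    closure-regular regular
  where
  open Dynamics P β (cycle⇒line cyclic β)
  open Draining V send⇒V
  open Extending Q
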